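{- Let $g\geq 3$ and $t\geq 1$ be integers, and let $k$ be a positive integer such that $k\geq (t+1)(g-1)$ if $g$ is even and $k\geq (t+2)(g+1)$ if $g$ is odd. Then there exists a digraph with girth $g$ and minimum outdegree at least $\lceil \frac{g}{g-1}k\rceil$ which contains at most $k-t$ pairwise vertex-disjoint directed cycles.
   Context: Digraphs are finite and simple (no loops, no parallel arcs; directed $2$-cycles allowed). A cycle means a directed cycle. The girth of a digraph is the length of its shortest directed cycle. -}

module Defs where

open import Data.Nat using (ℕ; zero; suc; _+_; _*_; _∸_; _≤_; NonZero)
open import Data.Nat.DivMod using (_/_)
open import Data.Fin using (Fin; zero; suc; inject₁; fromℕ)
open import Data.Bool using (Bool; true; false)
open import Data.Product using (Σ; _×_; ∃-syntax)
open import Function.Definitions using (Injective)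
open import Relation.Binary.PropositionalEquality using (_≡_; _≢_)

⌈_/_⌉ : ℕ → (b : ℕ) → .{{NonZero b}} → ℕ
⌈ a / b ⌉ = (a + b ∸ 1) / b

-- A finite simple digraph on vertex set Fin n: arc relation without loops.
-- (No parallel arcs by construction; directed 2-cycles are allowed.)
record Digraph : Set where
  field
    n        : ℕ
    arc      : Fin n → Fin n → Bool
    loopless : ∀ v → arc v v ≡ false
open Digraph public

Arc : (D : Digraph) → Fin (n D) → Fin (n D) → Set
Arc D u v = arc D u v ≡ true

record Cycle (D : Digraph) (ℓ : ℕ) : Set where
  field
    m      : ℕ
    len    : ℓ ≡ suc m
    vert   : Fin (suc m) → Fin (n D)
    inj    : Injective _≡_ _≡_ vert
    step   : ∀ (j : Fin m) → Arc D (vert (inject₁ j)) (vert (suc j))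
    close  : Arc D (vert (fromℕ m)) (vert zero)
open Cycle public

HasGirth : Digraph → ℕ → Set
HasGirth D g = Cycle D g × (∀ ℓ → Cycle D ℓ → g ≤ ℓ)

MinOutdegAtLeast : Digraph → ℕ → Set
MinOutdegAtLeast D d =
  ∀ (v : Fin (n D)) → Σ (Fin d → Fin (n D)) λ f →
    Injective _≡_ _≡_ f × (∀ i → Arc D v (f i))

Disjoint : {D : Digraph} {ℓ₁ ℓ₂ : ℕ} → Cycle D ℓ₁ → Cycle D ℓ₂ → Set
Disjoint C₁ C₂ = ∀ i j → vert C₁ i ≢ vert C₂ j

DisjointCycles : Digraph → ℕ → Set
DisjointCycles D r =
  Σ (Fin r → ℕ) λ len → Σ ((i : Fin r) → Cycle D (len i)) λ C →
    ∀ i j → i ≢ j → Disjoint (C i) (C j)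

AtMostDisjointCycles : Digraph → ℕ → Set
AtMostDisjointCycles D s = ∀ r → DisjointCycles D r → r ≤ s

{-# OPTIONS --safe #-}

-- Replace each vertex of the complete digraph on d + 1 vertices by a gadget: a path
-- runs through consecutive layers of d vertices before it may jump to the port of any
-- other gadget. A cycle uses the ports of at least two gadgets, so r disjoint cycles
-- need 2r ≤ d + 1. If one gadget has ⌊g/2⌋ layers and all others ⌈g/2⌉, then
-- crossing two different gadgets takes at least g steps, with equality attained.

module Submission where

open import Defs
open import Data.Nat using (ℕ; zero; suc; _+_; _*_; _∸_; _≤_; _<_; z≤n; s≤s; pred; NonZero; ⌊_/2⌋; ⌈_/2⌉)
open import Data.Nat.DivMod using (_%_; _mod_; m%n<n; n%n≡0; m<n⇒m%n≡m; m%n%n≡m%n; [m+n]%n≡m%n; %-distribˡ-+; m/n*n≤m; m≥n⇒m/n>0)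
open import Data.Nat.Properties
open import Data.Nat.Tactic.RingSolver using (solve-∀)
open import Data.Fin using (Fin; zero; suc; toℕ; fromℕ; fromℕ<; inject₁; punchIn)
open import Data.Fin.Properties as Fin using (toℕ-fromℕ<; toℕ-fromℕ; toℕ-inject₁; toℕ<n; toℕ-injective; *↔×; injective⇒≤; punchIn-injective; punchInᵢ≢i)
open import Data.Fin.Relation.Unary.Top using (view; ‵fromℕ; ‵inject₁)
open import Data.Bool using (true)
open import Data.Product using (Σ; _×_; _,_; proj₁; proj₂; ∃-syntax)
open import Data.Product.Properties using (≡-dec)
open import Data.Product.Function.NonDependent.Propositional using (_×-↔_)
open import Data.Sum using (_⊎_; inj₁; inj₂)
open import Function using (_∘_; _↔_; Inverse)
open import Function.Construct.Composition using (_↔-∘_)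
open import Function.Construct.Identity using (↔-id)
open import Function.Definitions using (Injective)
open import Relation.Binary.Definitions using (Decidable)
open import Relation.Binary.PropositionalEquality
open import Relation.Nullary using (¬_; Dec; yes; no; does; contradiction)
open import Relation.Nullary.Decidable using (dec-true; dec-false; _×-dec_; _⊎-dec_; ¬?)

-- Cycles unrolled into periodic walks.

does-true⇒ : ∀ {p} {P : Set p} (P? : Dec P) → does P? ≡ true → P
does-true⇒ (yes p) _ = p

toℕ-mod : ∀ i n .{{_ : NonZero n}} → toℕ (i mod n) ≡ i % n
toℕ-mod i n = toℕ-fromℕ< (m%n<n i n)

suc-% : ∀ i n .{{_ : NonZero n}} → suc (i % n) % n ≡ suc i % n
suc-% i n = begin
  (1 + i % n) % n          ≡⟨ %-distribˡ-+ 1 (i % n) n ⟩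
  (1 % n + i % n % n) % n  ≡⟨ cong (λ x → (1 % n + x) % n) (m%n%n≡m%n i n) ⟩
  (1 % n + i % n) % n      ≡⟨ %-distribˡ-+ 1 i n ⟨
  suc i % n                ∎
  where open ≡-Reasoning

mod-cong : ∀ {i j} n .{{_ : NonZero n}} → i % n ≡ j % n → i mod n ≡ j mod n
mod-cong {i} {j} n eq = toℕ-injective (trans (toℕ-mod i n) (trans eq (sym (toℕ-mod j n))))

toℕ-mod-id : ∀ {n} .{{_ : NonZero n}} (j : Fin n) → toℕ j mod n ≡ j
toℕ-mod-id {n} j = toℕ-injective (trans (toℕ-mod (toℕ j) n) (m<n⇒m%n≡m (toℕ<n j)))

suc-toℕ-mod : ∀ i n .{{_ : NonZero n}} → suc (toℕ (i mod n)) mod n ≡ suc i mod n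
suc-toℕ-mod i n = mod-cong {suc (toℕ (i mod n))} {suc i} n
  (trans (cong (λ x → suc x % n) (toℕ-mod i n)) (suc-% i n))

module _ {D : Digraph} {ℓ : ℕ} (C : Cycle D ℓ) where

  -- Unrolling the cycle over all of `ℕ` lets times be added freely, with no wraparound cases;
  -- `walk-period` is all that remembers the closing up.
  walk : ℕ → Fin (n D)
  walk i = vert C (i mod suc (m C))

  walk-period : ∀ i → walk (ℓ + i) ≡ walk i
  walk-period i = cong (vert C) (mod-cong {ℓ + i} {i} (suc (m C)) (trans
    (cong (_% suc (m C)) {ℓ + i} {i + suc (m C)} (trans (cong (_+ i) (len C)) (+-comm (suc (m C)) i)))
    ([m+n]%n≡m%n i (suc (m C)))))

  vert-step : ∀ j → Arc D (vert C j) (walk (suc (toℕ j)))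
  vert-step j with view j
  -- At the last index the successor is `suc (m C)`, which reduces to 0 modulo the length, so
  -- `close` supplies the arc.
  ... | ‵fromℕ = subst (Arc D (vert C (fromℕ (m C))) ∘ vert C)
    (mod-cong {0} {suc (toℕ (fromℕ (m C)))} (suc (m C))
      (sym (trans (cong (λ x → suc x % suc (m C)) (toℕ-fromℕ (m C))) (n%n≡0 (suc (m C))))))
    (close C)
  ... | ‵inject₁ i = subst (Arc D (vert C (inject₁ i)) ∘ vert C)
    (trans (sym (toℕ-mod-id (suc i))) (cong (λ x → suc x mod suc (m C)) (sym (toℕ-inject₁ i))))
    (step C i)

  walk-step : ∀ i → Arc D (walk i) (walk (suc i))
  walk-step i = subst (Arc D (walk i) ∘ vert C) (suc-toℕ-mod i (suc (m C))) (vert-step (i mod suc (m C)))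

-- The gadget digraph and its outdegree.

module Gadgets (a b e : ℕ) (a≤b : a ≤ b) where

  -- (v , l , i) is the i-th vertex of the layer of gadget v from which l further
  -- steps remain inside v. Layers above that of the port of v lie on no cycle.
  V : Set
  V = Fin (2 + e) × Fin (suc b) × Fin (suc e)

  gadget : V → Fin (2 + e)
  gadget = proj₁

  layer : V → ℕ
  layer v = toℕ (proj₁ (proj₂ v))

  portLayer : Fin (2 + e) → ℕ
  portLayer zero    = a
  portLayer (suc _) = b

  portLayer≤b : ∀ w → portLayer w ≤ b
  portLayer≤b zero    = a≤b
  portLayer≤b (suc _) = ≤-refl

  -- The position reached `c` steps after the port along the path of zeroth vertices; truncated
  -- subtraction makes it total in `c`.
  at : Fin (2 + e) → ℕ → V
  at w c = w , fromℕ< (s≤s (≤-trans (m∸n≤m (portLayer w) c) (portLayer≤b w))) , zero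

  layer-at : ∀ w c → layer (at w c) ≡ portLayer w ∸ c
  layer-at w c = toℕ-fromℕ< (s≤s (≤-trans (m∸n≤m (portLayer w) c) (portLayer≤b w)))

  port : Fin (2 + e) → V
  port w = at w 0

  -- Jumps land only on ports. Entering a gadget thus commits a walk to a full descent, and any two
  -- cycles that enter the same gadget share a vertex.
  Step : V → V → Set
  Step u v = (gadget u ≡ gadget v × layer u ≡ suc (layer v))
           ⊎ (layer u ≡ 0 × gadget u ≢ gadget v × v ≡ port (gadget v))

  step? : Decidable Step
  step? u v =
    (gadget u Fin.≟ gadget v ×-dec layer u ≟ suc (layer v))
    ⊎-dec (layer u ≟ 0 ×-dec ¬? (gadget u Fin.≟ gadget v)
           ×-dec ≡-dec Fin._≟_ (≡-dec Fin._≟_ Fin._≟_) v (port (gadget v)))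

  step-irrefl : ∀ u → ¬ Step u u
  step-irrefl _ (inj₁ (_ , eq))     = 1+n≢n (sym eq)
  step-irrefl _ (inj₂ (_ , ne , _)) = ne refl

  -- Unfolding the enumeration makes unification of encoded vertices get stuck.
  abstract
    V↔Fin : Fin ((2 + e) * (suc b * suc e)) ↔ V
    V↔Fin = (↔-id _ ×-↔ *↔×) ↔-∘ *↔×

  open Inverse V↔Fin using () renaming (to to decode; from to encode; strictlyInverseˡ to decode-encode; strictlyInverseʳ to encode-decode)

  encode-injective : ∀ {u v} → encode u ≡ encode v → u ≡ v
  encode-injective {u} {v} eq =
    trans (sym (decode-encode u)) (trans (cong decode eq) (decode-encode v))

  decode-injective : ∀ {i j} → decode i ≡ decode j → i ≡ j
  decode-injective {i} {j} eq =
    trans (sym (encode-decode i)) (trans (cong encode eq) (encode-decode j))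

  D : Digraph
  D = record
    { n        = (2 + e) * (suc b * suc e)
    ; arc      = λ i j → does (step? (decode i) (decode j))
    ; loopless = λ i → dec-false (step? (decode i) (decode i)) (step-irrefl (decode i))
    }

  arc-to-encode : ∀ i v → Step (decode i) v → Arc D i (encode v)
  arc-to-encode i v s =
    dec-true (step? (decode i) (decode (encode v))) (subst (Step (decode i)) (sym (decode-encode v)) s)

  -- Two counts agree: a layer has `suc e` vertices, and there are `suc e` gadgets other than `v`.
  successors : ∀ u → Σ (Fin (suc e) → V) λ f → Injective _≡_ _≡_ f × (∀ j → Step u (f j))
  successors (v , zero , _) =
    (λ j → port (punchIn v j))
    , (λ q → punchIn-injective v _ _ (cong gadget q))
    , (λ j → inj₂ (refl , (λ q → punchInᵢ≢i v j (sym q)) , refl))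
  successors (v , suc l , _) =
    (λ j → v , inject₁ l , j)
    , cong (proj₂ ∘ proj₂)
    , (λ j → inj₁ (refl , cong suc (sym (toℕ-inject₁ l))))

  outdegree : MinOutdegAtLeast D (suc e)
  outdegree i =
    let (f , f-injective , f-step) = successors (decode i)
    in encode ∘ f , (λ q → f-injective (encode-injective q)) , (λ j → arc-to-encode i (f j) (f-step j))

  -- Closed trails through the gadgets.

  module Trail (ℓ : ℕ) (0<ℓ : 0 < ℓ) (trail : ℕ → V)
    (trail-step : ∀ i → Step (trail i) (trail (suc i)))
    (trail-period : ∀ i → trail (ℓ + i) ≡ trail i) where

    -- A jump requires layer 0, so as long as steps remain the trail can only go down inside its
    -- gadget.
    trail-descend : ∀ i c l → layer (trail i) ≡ c + l →
      gadget (trail (c + i)) ≡ gadget (trail i) × layer (trail (c + i)) ≡ l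
    trail-descend i zero    l eq = refl , eq
    trail-descend i (suc c) l eq
      with trail-descend i c (suc l) (trans eq (sym (+-suc c l))) | trail-step (c + i)
    ... | same , atl | inj₁ (same′ , down) = trans (sym same′) same , suc-injective (trans (sym down) atl)
    ... | same , atl | inj₂ (bottom , _)   = contradiction (trans (sym atl) bottom) λ ()

    trail-exit : ∀ i → let j = suc (layer (trail i) + i) in
      gadget (trail i) ≢ gadget (trail j) × trail j ≡ port (gadget (trail j))
    trail-exit i
      with trail-descend i (layer (trail i)) 0 (sym (+-identityʳ _)) | trail-step (layer (trail i) + i)
    ... | same , atl | inj₁ (_ , down)     = contradiction (trans (sym atl) down) λ ()
    ... | same , atl | inj₂ (_ , ne , ent) = (λ q → ne (trans same q)) , ent

    -- The first two entries into a gadget after time 0. Waiting until `T₁` discards the possibly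
    -- partial descent at the arbitrary starting vertex, so the descents from `T₁` and `T₂` are full
    -- ones.
    T₁ T₂ : ℕ
    T₁ = suc (layer (trail 0) + 0)
    T₂ = suc (layer (trail T₁) + T₁)

    w₁ w₂ : Fin (2 + e)
    w₁ = gadget (trail T₁)
    w₂ = gadget (trail T₂)

    w₁≢w₂ : w₁ ≢ w₂
    w₁≢w₂ = proj₁ (trail-exit T₁)

    at-port₁ : trail T₁ ≡ port w₁
    at-port₁ = proj₂ (trail-exit 0)

    at-port₂ : trail T₂ ≡ port w₂
    at-port₂ = proj₂ (trail-exit T₁)

    layer₁ : layer (trail T₁) ≡ portLayer w₁
    layer₁ = trans (cong layer at-port₁) (layer-at w₁ 0)

    layer₂ : layer (trail T₂) ≡ portLayer w₂
    layer₂ = trans (cong layer at-port₂) (layer-at w₂ 0)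

    -- Otherwise the `ℓ` steps after `T₁` would all be descents and lower the layer by `ℓ`, while
    -- periodicity restores it.
    portLayer₁<ℓ : portLayer w₁ < ℓ
    portLayer₁<ℓ = ≰⇒> λ ℓ≤ →
      let l          = portLayer w₁ ∸ ℓ
          l+ℓ        = trans layer₁ (sym (m+[n∸m]≡n ℓ≤))
          (_ , down) = trail-descend T₁ ℓ l l+ℓ
      in <⇒≢ (+-monoˡ-< l 0<ℓ) (trans (sym down) (trans (cong layer (trail-period T₁)) l+ℓ))

    -- By `return`, one period after `T₁` is `c` steps after `T₂`, where `c` is what remains of `ℓ`
    -- after the crossing of `w₁`. If `c` were at most `portLayer w₂`, the trail would still be in
    -- `w₂` then, yet by periodicity it is in `w₁`.
    length-bound : suc (portLayer w₁ + suc (portLayer w₂)) ≤ ℓ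
    length-bound = subst (suc (portLayer w₁ + suc (portLayer w₂)) ≤_) (m+[n∸m]≡n portLayer₁<ℓ)
      (s≤s (+-monoʳ-≤ (portLayer w₁) (≰⇒> λ c≤ →
        let c          = ℓ ∸ suc (portLayer w₁)
            (same , _) = trail-descend T₂ c (portLayer w₂ ∸ c) (trans layer₂ (sym (m+[n∸m]≡n c≤)))
        in w₁≢w₂ (trans (sym (cong gadget (trail-period T₁)))
             (trans (cong (gadget ∘ trail) (return c (m+[n∸m]≡n portLayer₁<ℓ))) same)))))
      where
      open ≡-Reasoning
      return : ∀ c → suc (portLayer w₁) + c ≡ ℓ → ℓ + T₁ ≡ c + T₂
      return c eq = begin
        ℓ + T₁                              ≡⟨ cong (_+ T₁) eq ⟨
        suc (portLayer w₁) + c + T₁         ≡⟨ cong (_+ T₁) (+-comm (suc (portLayer w₁)) c) ⟩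
        c + suc (portLayer w₁) + T₁         ≡⟨ +-assoc c (suc (portLayer w₁)) T₁ ⟩
        c + suc (portLayer w₁ + T₁)         ≡⟨ cong (λ x → c + suc (x + T₁)) layer₁ ⟨
        c + T₂                              ∎

    portGadget : Fin 2 → Fin (2 + e)
    portGadget zero       = w₁
    portGadget (suc zero) = w₂

    portGadget-injective : Injective _≡_ _≡_ portGadget
    portGadget-injective {zero}     {zero}     _  = refl
    portGadget-injective {zero}     {suc zero} eq = contradiction eq w₁≢w₂
    portGadget-injective {suc zero} {zero}     eq = contradiction (sym eq) w₁≢w₂
    portGadget-injective {suc zero} {suc zero} _  = refl

    port-on-trail : ∀ s → ∃[ i ] trail i ≡ port (portGadget s)
    port-on-trail zero       = T₁ , at-port₁
    port-on-trail (suc zero) = T₂ , at-port₂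

  module CycleTrail {ℓ : ℕ} (C : Cycle D ℓ) = Trail ℓ
    (subst (0 <_) (sym (len C)) (s≤s z≤n))
    (λ i → decode (walk C i))
    (λ i → does-true⇒ (step? (decode (walk C i)) (decode (walk C (suc i)))) (walk-step C i))
    (λ i → cong decode (walk-period C i))

  open CycleTrail

  -- Girth lower bound and cycle packing.

  -- Only one gadget has the smaller depth `a`, so two distinct gadgets cannot both be shallow.
  portLayer-sum : ∀ {w x} → w ≢ x → a + b ≤ portLayer w + portLayer x
  portLayer-sum {zero}  {zero}  ne = contradiction refl ne
  portLayer-sum {zero}  {suc x} ne = ≤-refl
  portLayer-sum {suc w} {zero}  ne = ≤-reflexive (+-comm a b)
  portLayer-sum {suc w} {suc x} ne = +-monoˡ-≤ b a≤b

  girth-bound : ∀ ℓ → Cycle D ℓ → 2 + (a + b) ≤ ℓ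
  girth-bound ℓ C = ≤-trans
    (s≤s (≤-trans (s≤s (portLayer-sum (w₁≢w₂ C))) (≤-reflexive (sym (+-suc _ _)))))
    (length-bound C)

  -- Each cycle is charged to two gadgets whose ports it visits. A gadget charged by two different
  -- cycles would put its port on both, against disjointness.
  packing-bound : ∀ r → DisjointCycles D r → r * 2 ≤ 2 + e
  packing-bound r (_ , C , disj) = injective⇒≤ {f = used ∘ Inverse.to pairs} λ {x} {y} eq →
    trans (sym (Inverse.strictlyInverseʳ pairs x))
      (trans (cong (Inverse.from pairs) (used-injective (Inverse.to pairs x) (Inverse.to pairs y) eq))
        (Inverse.strictlyInverseʳ pairs y))
    where
    pairs : Fin (r * 2) ↔ (Fin r × Fin 2)
    pairs = *↔×

    used : Fin r × Fin 2 → Fin (2 + e)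
    used (i , s) = portGadget (C i) s

    used-injective : ∀ x y → used x ≡ used y → x ≡ y
    used-injective (i , s) (j , s′) eq with i Fin.≟ j
    ... | yes refl = cong (i ,_) (portGadget-injective (C i) eq)
    ... | no  i≢j  = contradiction
      (decode-injective (trans (proj₂ (port-on-trail (C i) s))
        (trans (cong port eq) (sym (proj₂ (port-on-trail (C j) s′))))))
      (disj i j i≢j _ _)

  -- A cycle attaining the girth.

  at-step : ∀ w c → c < portLayer w → Step (at w c) (at w (suc c))
  at-step w c c< = inj₁ (refl , trans (layer-at w c)
    (trans (+-∸-assoc 1 c<) (cong suc (sym (layer-at w (suc c))))))

  at-exit : ∀ {w x} → w ≢ x → Step (at w (portLayer w)) (port x)
  at-exit {w} w≢x = inj₂ (trans (layer-at w (portLayer w)) (n∸n≡0 (portLayer w)) , w≢x , refl)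

  -- Times 0 to `a` run down gadget `zero`; the next `suc b` times run down gadget `suc zero`.
  loop : ℕ → V
  loop c with c ≤? a
  ... | yes _ = at zero c
  ... | no  _ = at (suc zero) (c ∸ suc a)

  loop-step : ∀ c → c < suc (a + b) → Step (loop c) (loop (suc c))
  loop-step c c< with c ≤? a | suc c ≤? a
  ... | yes _   | yes c<a = at-step zero c c<a
  ... | no c≰a  | yes c<a = contradiction (<⇒≤ c<a) c≰a
  -- Here `c` equals `a`: the bottom of gadget `zero`, where the jump takes place.
  ... | yes c≤a | no c≮a  with refl ← ≤-antisym c≤a (≮⇒≥ c≮a) =
    subst (λ x → Step (at zero a) (at (suc zero) x)) (sym (n∸n≡0 a)) (at-exit λ ())
  ... | no c≰a  | no _    =
    subst (λ x → Step (at (suc zero) (c ∸ suc a)) (at (suc zero) x)) (sym (+-∸-assoc 1 (≰⇒> c≰a)))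
      (at-step (suc zero) (c ∸ suc a)
        (+-cancelˡ-< (suc a) _ _ (subst (_< suc a + b) (sym (m+[n∸m]≡n (≰⇒> c≰a))) c<)))

  loop-close : Step (loop (suc (a + b))) (loop 0)
  loop-close with suc (a + b) ≤? a
  ... | yes 1+a+b≤a = contradiction (≤-trans 1+a+b≤a (m≤m+n a b)) 1+n≰n
  ... | no _ rewrite m+n∸m≡n a b = at-exit λ ()

  -- Recovers the time from the vertex; as a left inverse of `loop` it gives injectivity of the
  -- cycle.
  rank : V → ℕ
  rank (zero  , l , _) = a ∸ toℕ l
  rank (suc _ , l , _) = suc a + (b ∸ toℕ l)

  rank-loop : ∀ c → c ≤ suc (a + b) → rank (loop c) ≡ c
  rank-loop c c≤ with c ≤? a
  ... | yes c≤a = trans (cong (a ∸_) (layer-at zero c)) (m∸[m∸n]≡n c≤a)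
  ... | no  c≰a = trans (cong (λ x → suc a + (b ∸ x)) (layer-at (suc zero) (c ∸ suc a)))
    (trans (cong (suc a +_) (m∸[m∸n]≡n (m≤n+o⇒m∸n≤o c (suc a) c≤))) (m+[n∸m]≡n (≰⇒> c≰a)))

  girth-cycle : Cycle D (2 + (a + b))
  girth-cycle = record
    { m     = suc (a + b)
    ; len   = refl
    ; vert  = λ j → encode (loop (toℕ j))
    ; inj   = λ {i} {j} eq → toℕ-injective (trans (sym (rank-loop (toℕ i) (≤-pred (toℕ<n i))))
                (trans (cong rank (encode-injective eq)) (rank-loop (toℕ j) (≤-pred (toℕ<n j)))))
    ; step  = λ j → subst (λ c → Arc D (encode (loop c)) (encode (loop (suc (toℕ j))))) (sym (toℕ-inject₁ j))
                (step⇒arc _ _ (loop-step (toℕ j) (toℕ<n j)))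
    ; close = subst (λ c → Arc D (encode (loop c)) (encode (loop 0))) (sym (toℕ-fromℕ (suc (a + b))))
                (step⇒arc _ _ loop-close)
    }
    where
    step⇒arc : ∀ u v → Step u v → Arc D (encode u) (encode v)
    step⇒arc u v s = arc-to-encode (encode u) v (subst (λ x → Step x v) (sym (decode-encode u)) s)

-- Arithmetic of the bounds and assembly.

⌈/⌉-upper : ∀ a b → ⌈ a / suc b ⌉ * suc b ≤ a + b
⌈/⌉-upper a b = ≤-trans (m/n*n≤m (a + suc b ∸ 1) (suc b)) (≤-reflexive (cong pred (+-suc a b)))

⌈/⌉-positive : ∀ {a} b → 1 ≤ a → 1 ≤ ⌈ a / suc b ⌉
⌈/⌉-positive {suc a} b _ = m≥n⇒m/n>0 (m≤n+m (suc b) a)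

-- With `x` standing for g - 3, both parity hypotheses are reduced to the single inequality 2t(g -
-- 1) ≤ k(g - 2) that the counting uses.
threshold : ∀ x t k →
  ((3 + x) % 2 ≡ 0 → (t + 1) * (2 + x) ≤ k) →
  ((3 + x) % 2 ≡ 1 → (t + 2) * (3 + x + 1) ≤ k) →
  2 * t * (2 + x) ≤ k * (1 + x)
threshold x t k even odd with (3 + x) % 2 in eq | m%n<n (3 + x) 2
-- Girth 3 is odd. For even g this leaves g - 2 ≥ 2, which supplies the factor 2 in front of `t`.
threshold zero    t k even odd | 0 | _ = contradiction eq λ ()
threshold (suc y) t k even odd | 0 | _ = begin
  2 * t * (3 + y)                                                  ≤⟨ m≤m+n _ _ ⟩
  -- The added term is the exact surplus of the right side, so the inequality becomes a polynomial
  -- identity without subtraction.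
  2 * t * (3 + y) + (2 * (3 + y) + y * ((t + 1) * (3 + y)))        ≡⟨ expand y t ⟩
  (t + 1) * (3 + y) * (2 + y)                                      ≤⟨ *-monoˡ-≤ (2 + y) (even refl) ⟩
  k * (2 + y)                                                      ∎
  where
  open ≤-Reasoning
  expand : ∀ y t → 2 * t * (3 + y) + (2 * (3 + y) + y * ((t + 1) * (3 + y))) ≡ (t + 1) * (3 + y) * (2 + y)
  expand = solve-∀
threshold x t k even odd | 1 | _ = begin
  2 * t * (2 + x)                                                  ≤⟨ m≤m+n _ _ ⟩
  2 * t * (2 + x) + (t * (3 * x + x * x) + 2 * (4 + x) * (1 + x))  ≡⟨ expand x t ⟩
  (t + 2) * (3 + x + 1) * (1 + x)                                  ≤⟨ *-monoˡ-≤ (1 + x) (odd refl) ⟩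
  k * (1 + x)                                                      ∎
  where
  open ≤-Reasoning
  expand : ∀ x t → 2 * t * (2 + x) + (t * (3 * x + x * x) + 2 * (4 + x) * (1 + x)) ≡ (t + 2) * (3 + x + 1) * (1 + x)
  expand = solve-∀
threshold x t k even odd | suc (suc _) | s≤s (s≤s ())

-- Clearing the denominator g - 1 and assuming k < r + t, the packing bound, the rounding error g -
-- 2 of the ceiling and `small` add up to exactly one less than 2(k + 1)(g - 1), a contradiction.
few-cycles : ∀ x t k d r →
  2 * t * (2 + x) ≤ k * (1 + x) →
  d * (2 + x) ≤ (3 + x) * k + (1 + x) →
  r * 2 ≤ 1 + d → r + t ≤ k
few-cycles x t k d r small upper pack = ≮⇒≥ λ k<r+t → n≮n _ (begin-strict
  2 * suc k * (2 + x)                                        ≤⟨ *-monoˡ-≤ (2 + x) (*-monoʳ-≤ 2 k<r+t) ⟩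
  2 * (r + t) * (2 + x)                                      ≡⟨ e₁ x t r ⟩
  r * 2 * (2 + x) + 2 * t * (2 + x)                          ≤⟨ +-mono-≤ (*-monoˡ-≤ (2 + x) pack) small ⟩
  (1 + d) * (2 + x) + k * (1 + x)                            ≤⟨ +-monoˡ-≤ (k * (1 + x)) (+-monoʳ-≤ (2 + x) upper) ⟩
  2 + x + ((3 + x) * k + (1 + x)) + k * (1 + x)              <⟨ n<1+n _ ⟩
  1 + (2 + x + ((3 + x) * k + (1 + x)) + k * (1 + x))        ≡⟨ e₂ x k ⟩
  2 * suc k * (2 + x)                                        ∎)
  where
  open ≤-Reasoning
  e₁ : ∀ x t r → 2 * (r + t) * (2 + x) ≡ r * 2 * (2 + x) + 2 * t * (2 + x)
  e₁ = solve-∀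
  e₂ : ∀ x k → 1 + (2 + x + ((3 + x) * k + (1 + x)) + k * (1 + x)) ≡ 2 * suc k * (2 + x)
  e₂ = solve-∀

-- Here `x` is g - 2, split as evenly as possible between the two depths. Positivity of `d` lets it
-- be written as `suc e`, the common size of the layers.
gadget-digraph : ∀ x d → 1 ≤ d → Σ Digraph λ D →
  HasGirth D (2 + x) × MinOutdegAtLeast D d × (∀ r → DisjointCycles D r → r * 2 ≤ 1 + d)
gadget-digraph x (suc e) _ = D , subst (HasGirth D) (cong (2 +_) (⌊n/2⌋+⌈n/2⌉≡n x)) (girth-cycle , girth-bound)
  , outdegree , packing-bound
  where open Gadgets ⌊ x /2⌋ ⌈ x /2⌉ e (⌊n/2⌋≤⌈n/2⌉ x)

theorem2 : (g t k : ℕ) → 3 ≤ g → 1 ≤ t → 1 ≤ k →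
    (g % 2 ≡ 0 → (t + 1) * (g ∸ 1) ≤ k) →
    (g % 2 ≡ 1 → (t + 2) * (g + 1) ≤ k) →
    Σ Digraph λ D →
    HasGirth D g ×
    MinOutdegAtLeast D ⌈ g * k / suc (g ∸ 2) ⌉ ×
    AtMostDisjointCycles D (k ∸ t)
theorem2 (suc (suc (suc x))) t k (s≤s (s≤s (s≤s z≤n))) _ 1≤k even odd =
  let d = ⌈ (3 + x) * k / suc (suc x) ⌉
      (D , girth , outdeg , pack) =
        gadget-digraph (suc x) d (⌈/⌉-positive (suc x) (≤-trans 1≤k (m≤m+n k ((2 + x) * k))))
  -- Truncation in `k ∸ t` is harmless, since the bound is obtained in the form `r + t ≤ k`.
  in D , girth , outdeg , λ r cycles → m+n≤o⇒m≤o∸n r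
       (few-cycles x t k d r (threshold x t k even odd) (⌈/⌉-upper ((3 + x) * k) (suc x)) (pack r cycles))
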